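{- Let $G$ be a graph on the vertex set $\{1,\dots,n\}$ with adjacency matrix $\Gamma$ over $\mathbb{F}_2$, and let $q(G,x)=\sum_{i=0}^n a_i x^i$ be its interlace polynomial. Then $|\Sigma_e(G)|$ divides every coefficient $a_i$. In particular, if $\Sigma_e(G)\neq\{0\}$, then all coefficients $a_i$ are even.
   Context: Graphs are finite, undirected and simple; the adjacency matrix $\Gamma$ is regarded as a matrix over $\mathbb{F}_2$ (symmetric, zero diagonal). For $\omega\subseteq\{1,\dots,n\}$, $\Gamma[\omega]=(\Gamma_{ij})_{i,j\in\omega}$, and $s(X)$ denotes the corank (dimension of the kernel) over $\mathbb{F}_2$ of a square matrix $X$, with $s(\Gamma[\emptyset])=0$. The interlace polynomial of $G$ is the integer polynomial $q(G,x)=\sum_{\omega\subseteq\{1,\dots,n\}}(x-1)^{s(\Gamma[\omega])}$. For $x\in\mathbb{F}_2^n$, $\hat{x}$ is the diagonal matrix with the entries of $x$ on its diagonal. For a diagonal $n\times n$ matrix $A$ over $\mathbb{F}_2$, $H^A(\Gamma)=((A+I)\Gamma+A)(A\Gamma+A+I)^{ -1}$, defined when $A\Gamma+A+I$ is nonsingular. $\Sigma_e(G)$ is the set of all $x\in\mathbb{F}_2^n$ for which $H^{\hat{x}}(\Gamma)$ is defined and equals $\Gamma$; equivalently, the linear space $\Sigma_e(G)=\{x\in\mathbb{F}_2^n\mid(\Gamma+I)\hat{x}(\Gamma+I)=0\}$ (over $\mathbb{F}_2$). -}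

module Defs where

open import Algebra.Bundles using (CommutativeRing)
open import Data.Bool using (Bool; true; false; _∧_; _xor_)
open import Data.Bool.Properties as Bool
  using (xor-∧-commutativeRing; xor-identityˡ; xor-identityʳ; xor-assoc; xor-comm; xor-same;
         ∧-zeroʳ; ∧-distribˡ-xor)
open import Data.Fin using (Fin; zero; suc)
open import Data.Fin.Properties using () renaming (_≟_ to _≟ᶠ_)
open import Data.Fin.Subset using (Subset; inside; outside; ∣_∣)
open import Data.Fin.Subset.Properties using (anySubset?)
open import Data.Integer as ℤ using (ℤ; 0ℤ; 1ℤ; -1ℤ)
open import Data.List as List using (List; []; _∷_; _++_)
open import Data.Nat using (ℕ; zero; suc)
open import Data.Product using (∃; Σ-syntax; _×_; _,_; proj₁; proj₂)
open import Data.Vec as Vec using (Vec; []; _∷_; lookup; tabulate; replicate; zipWith)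
open import Data.Vec.Properties as Vec
  using (≡-dec; lookup-replicate; lookup-zipWith; tabulate-cong; ∷-injectiveˡ; ∷-injectiveʳ)
open import Data.Vec.Relation.Unary.All using (All; []; _∷_)
open import Data.Vec.Relation.Unary.All.Properties using (map⁺)
open import Function using (_∘_)
open import Level using (0ℓ)
open import Relation.Binary using (Rel; Symmetric; Irreflexive; DecidableEquality)
  renaming (Decidable to Decidable₂)
open import Relation.Binary.PropositionalEquality
  using (_≡_; refl; sym; trans; cong; cong₂; module ≡-Reasoning)
open import Relation.Nullary using (Dec; yes; no; does)
open import Relation.Nullary.Decidable using (map′; _×-dec_)
open import Relation.Nullary.Negation using (contradiction)
open import Relation.Unary using (Pred; Decidable)

open import Algebra.Properties.Semiring.Sum (CommutativeRing.semiring xor-∧-commutativeRing)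
  using (sum; sum-syntax; sum-cong-≗; sum-replicate-zero; ∑-distrib-+) public

private
  variable
    k m n d : ℕ

-- The field operations are _xor_ and _∧_.  With this choice 𝔽₂ⁿ and the
-- subsets of Fin n are the same type, Vec Bool n = Subset n.
𝔽₂ : Set
𝔽₂ = Bool

infixl 6 _⊕_ _+ᴹ_
infixl 7 _*ᴹ_ _*ᵥ_

𝟎 : Vec 𝔽₂ n
𝟎 = replicate _ false

_⊕_ : Vec 𝔽₂ n → Vec 𝔽₂ n → Vec 𝔽₂ n
_⊕_ = zipWith _xor_

_·_ : 𝔽₂ → Vec 𝔽₂ n → Vec 𝔽₂ n
a · v = Vec.map (a ∧_) v

𝔽₂^ : ∀ n → List (Vec 𝔽₂ n)
𝔽₂^ zero    = [] ∷ []
𝔽₂^ (suc n) = List.map (false ∷_) (𝔽₂^ n) ++ List.map (true ∷_) (𝔽₂^ n)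

Matrix : ℕ → ℕ → Set
Matrix m n = Vec (Vec 𝔽₂ n) m

entry : Matrix m n → Fin m → Fin n → 𝔽₂
entry M i j = lookup (lookup M i) j

matrix : (Fin m → Fin n → 𝔽₂) → Matrix m n
matrix f = tabulate λ i → tabulate λ j → f i j

_≟ᴹ_ : DecidableEquality (Matrix m n)
_≟ᴹ_ = ≡-dec (≡-dec Bool._≟_)

_+ᴹ_ : Matrix m n → Matrix m n → Matrix m n
M +ᴹ N = matrix λ i j → entry M i j xor entry N i j

_*ᴹ_ : Matrix m k → Matrix k n → Matrix m n
_*ᴹ_ {k = k} M N = matrix λ i j → ∑[ l < k ] (entry M i l ∧ entry N l j)

_*ᵥ_ : Matrix m n → Vec 𝔽₂ n → Vec 𝔽₂ m
_*ᵥ_ {n = n} M v = tabulate λ i → ∑[ j < n ] (entry M i j ∧ lookup v j)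

diag : Vec 𝔽₂ n → Matrix n n
diag x = matrix λ i j → does (i ≟ᶠ j) ∧ lookup x i

𝐈 : Matrix n n
𝐈 = matrix λ i j → does (i ≟ᶠ j)

Invertible : Pred (Matrix n n) 0ℓ
Invertible M = ∃ λ N → M *ᴹ N ≡ 𝐈 × N *ᴹ M ≡ 𝐈

linComb : Vec 𝔽₂ d → Vec (Vec 𝔽₂ n) d → Vec 𝔽₂ n
linComb []       []       = 𝟎
linComb (c ∷ cs) (b ∷ bs) = (c · b) ⊕ linComb cs bs

-- Over 𝔽₂, closure under scalar multiplication is automatic.
record IsSubspace (V : Pred (Vec 𝔽₂ n) 0ℓ) : Set where
  field
    𝟎-closed : V 𝟎
    ⊕-closed : ∀ {u v} → V u → V v → V (u ⊕ v)

record IsBasis (V : Pred (Vec 𝔽₂ n) 0ℓ) (B : Vec (Vec 𝔽₂ n) d) : Set where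
  field
    members     : All V B
    independent : ∀ {c} → linComb c B ≡ 𝟎 → c ≡ 𝟎
    spanning    : ∀ {v} → V v → ∃ λ c → linComb c B ≡ v

private
  ⊕-identityˡ : (v : Vec 𝔽₂ n) → 𝟎 ⊕ v ≡ v
  ⊕-identityˡ = Vec.zipWith-identityˡ xor-identityˡ

  ⊕-identityʳ : (v : Vec 𝔽₂ n) → v ⊕ 𝟎 ≡ v
  ⊕-identityʳ = Vec.zipWith-identityʳ xor-identityʳ

  false· : (v : Vec 𝔽₂ n) → false · v ≡ 𝟎
  false· v = Vec.map-const v false

  true· : (v : Vec 𝔽₂ n) → true · v ≡ v
  true· = Vec.map-id

  ⊕-cancel : (u v : Vec 𝔽₂ n) → u ⊕ (v ⊕ u) ≡ v
  ⊕-cancel u v = begin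
    u ⊕ (v ⊕ u) ≡⟨ cong (u ⊕_) (Vec.zipWith-comm xor-comm v u) ⟩
    u ⊕ (u ⊕ v) ≡⟨ Vec.zipWith-assoc xor-assoc u u v ⟨
    (u ⊕ u) ⊕ v ≡⟨ cong (_⊕ v) (self u) ⟩
    𝟎 ⊕ v       ≡⟨ ⊕-identityˡ v ⟩
    v           ∎
    where
    open ≡-Reasoning
    self : ∀ {n} (u : Vec 𝔽₂ n) → u ⊕ u ≡ 𝟎
    self []      = refl
    self (a ∷ u) = cong₂ _∷_ (xor-same a) (self u)

  linComb-lift : (c : Vec 𝔽₂ d) (B : Vec (Vec 𝔽₂ n) d) →
                 linComb c (Vec.map (false ∷_) B) ≡ false ∷ linComb c B
  linComb-lift []       []       = refl
  linComb-lift (c ∷ cs) (b ∷ bs) rewrite linComb-lift cs bs =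
    cong₂ _∷_ (trans (xor-identityʳ (c ∧ false)) (∧-zeroʳ c)) refl

subspace-basis : (V : Pred (Vec 𝔽₂ n) 0ℓ) → Decidable V → IsSubspace V →
                 ∃ λ d → Σ[ B ∈ Vec (Vec 𝔽₂ n) d ] IsBasis V B
subspace-basis {zero} V V? sub = 0 , [] , record
  { members     = []
  ; independent = λ { {[]} _ → refl }
  ; spanning    = λ { {[]} _ → [] , refl }
  }
subspace-basis {suc n} V V? sub = extend (anySubset? (V? ∘ (true ∷_)))
  where
  open IsSubspace sub
  V₀ : Pred (Vec 𝔽₂ n) 0ℓ
  V₀ = V ∘ (false ∷_)

  ih : ∃ λ d → Σ[ B ∈ Vec (Vec 𝔽₂ n) d ] IsBasis V₀ B
  ih = subspace-basis V₀ (V? ∘ (false ∷_)) record { 𝟎-closed = 𝟎-closed ; ⊕-closed = ⊕-closed }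

  B₀ : Matrix (proj₁ ih) n
  B₀ = proj₁ (proj₂ ih)
  module B₀ = IsBasis (proj₂ (proj₂ ih))

  extend : Dec (∃ λ u → V (true ∷ u)) → ∃ λ d → Σ[ B ∈ Vec (Vec 𝔽₂ (suc n)) d ] IsBasis V B
  extend (no ∄u) = _ , Vec.map (false ∷_) B₀ , record
    { members     = map⁺ B₀.members
    ; independent = λ {c} eq → B₀.independent (∷-injectiveʳ (trans (sym (linComb-lift c B₀)) eq))
    ; spanning    = span
    }
    where
    span : ∀ {v} → V v → ∃ λ c → linComb c (Vec.map (false ∷_) B₀) ≡ v
    span {true  ∷ w} Vv = contradiction (w , Vv) ∄u
    span {false ∷ w} Vv with c , eq ← B₀.spanning Vv =
      c , trans (linComb-lift c B₀) (cong (false ∷_) eq)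
  extend (yes (u , Vu)) = _ , B , record
    { members     = Vu ∷ map⁺ B₀.members
    ; independent = indep
    ; spanning    = span
    }
    where
    B : Matrix (suc (proj₁ ih)) (suc n)
    B = (true ∷ u) ∷ Vec.map (false ∷_) B₀

    indep : ∀ {c} → linComb c B ≡ 𝟎 → c ≡ 𝟎
    indep {false ∷ cs} eq rewrite linComb-lift cs B₀ | false· u | ⊕-identityˡ (linComb cs B₀) =
      cong (false ∷_) (B₀.independent (∷-injectiveʳ eq))
    indep {true ∷ cs} eq rewrite linComb-lift cs B₀ = contradiction (∷-injectiveˡ eq) λ ()

    span : ∀ {v} → V v → ∃ λ c → linComb c B ≡ v
    span {false ∷ w} Vv with c , eq ← B₀.spanning Vv = false ∷ c , (begin
      (false · (true ∷ u)) ⊕ linComb c (Vec.map (false ∷_) B₀)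
        ≡⟨ cong₂ _⊕_ (false· (true ∷ u)) (linComb-lift c B₀) ⟩
      𝟎 ⊕ (false ∷ linComb c B₀)  ≡⟨ ⊕-identityˡ _ ⟩
      false ∷ linComb c B₀         ≡⟨ cong (false ∷_) eq ⟩
      false ∷ w                    ∎)
      where open ≡-Reasoning
    span {true ∷ w} Vv with c , eq ← B₀.spanning (⊕-closed Vv Vu) = true ∷ c , (begin
      (true · (true ∷ u)) ⊕ linComb c (Vec.map (false ∷_) B₀)
        ≡⟨ cong₂ _⊕_ (true· (true ∷ u)) (linComb-lift c B₀) ⟩
      true ∷ (u ⊕ linComb c B₀)   ≡⟨ cong (λ z → true ∷ (u ⊕ z)) eq ⟩
      true ∷ (u ⊕ (w ⊕ u))        ≡⟨ cong (true ∷_) (⊕-cancel u w) ⟩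
      true ∷ w                     ∎)
      where open ≡-Reasoning

Kernel : Matrix m n → Pred (Vec 𝔽₂ n) 0ℓ
Kernel M v = M *ᵥ v ≡ 𝟎

Kernel? : (M : Matrix m n) → Decidable (Kernel M)
Kernel? M v = ≡-dec Bool._≟_ (M *ᵥ v) 𝟎

private
  tabulate-false : tabulate {n = n} (λ _ → false) ≡ 𝟎
  tabulate-false {zero}  = refl
  tabulate-false {suc n} = cong (false ∷_) tabulate-false

  tabulate-⊕ : (f g : Fin n → 𝔽₂) → tabulate (λ i → f i xor g i) ≡ tabulate f ⊕ tabulate g
  tabulate-⊕ {zero}  f g = refl
  tabulate-⊕ {suc n} f g = cong₂ _∷_ refl (tabulate-⊕ (f ∘ suc) (g ∘ suc))

  *ᵥ-𝟎 : (M : Matrix m n) → M *ᵥ 𝟎 ≡ 𝟎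
  *ᵥ-𝟎 {n = n} M = trans (tabulate-cong λ i → trans
    (sum-cong-≗ λ j → trans (cong (entry M i j ∧_) (lookup-replicate j false)) (∧-zeroʳ (entry M i j)))
    (sum-replicate-zero n)) tabulate-false

  *ᵥ-⊕ : (M : Matrix m n) (u v : Vec 𝔽₂ n) → M *ᵥ (u ⊕ v) ≡ M *ᵥ u ⊕ M *ᵥ v
  *ᵥ-⊕ M u v = trans (tabulate-cong λ i → trans
    (sum-cong-≗ λ j → trans (cong (entry M i j ∧_) (lookup-zipWith _xor_ j u v))
                            (∧-distribˡ-xor (entry M i j) _ _))
    (∑-distrib-+ (λ j → entry M i j ∧ lookup u j) (λ j → entry M i j ∧ lookup v j)))
    (tabulate-⊕ _ _)

Kernel-isSubspace : (M : Matrix m n) → IsSubspace (Kernel M)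
Kernel-isSubspace M = record
  { 𝟎-closed = *ᵥ-𝟎 M
  ; ⊕-closed = λ {u} {v} p q → trans (*ᵥ-⊕ M u v) (trans (cong₂ _⊕_ p q) (⊕-identityˡ 𝟎))
  }

kernel-basis : (M : Matrix m n) → ∃ λ d → Σ[ B ∈ Vec (Vec 𝔽₂ n) d ] IsBasis (Kernel M) B
kernel-basis M = subspace-basis (Kernel M) (Kernel? M) (Kernel-isSubspace M)

corank : Matrix n n → ℕ
corank M = proj₁ (kernel-basis M)

record Graph (n : ℕ) : Set₁ where
  infix 4 _~_ _~?_
  field
    _~_      : Rel (Fin n) 0ℓ
    ~-sym    : Symmetric _~_
    ~-irrefl : Irreflexive _≡_ _~_
    _~?_     : Decidable₂ _~_

adjacency : Graph n → Matrix n n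
adjacency G = matrix λ i j → does (i ~? j)
  where open Graph G

elements : (ω : Subset n) → Vec (Fin n) ∣ ω ∣
elements []            = []
elements (inside  ∷ ω) = zero ∷ Vec.map suc (elements ω)
elements (outside ∷ ω) = Vec.map suc (elements ω)

_[_] : Matrix n n → (ω : Subset n) → Matrix ∣ ω ∣ ∣ ω ∣
M [ ω ] = matrix λ i j → entry M (lookup (elements ω) i) (lookup (elements ω) j)

-- Coefficients from the constant term upwards; trailing zeros are allowed.
Polynomial : Set
Polynomial = List ℤ

coeff : Polynomial → ℕ → ℤ
coeff []      _       = 0ℤ
coeff (a ∷ p) zero    = a
coeff (a ∷ p) (suc i) = coeff p i

infixl 6 _+ₚ_
infixl 7 _*ₚ_
infixr 8 _^ₚ_

_+ₚ_ : Polynomial → Polynomial → Polynomial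
[]      +ₚ q       = q
(a ∷ p) +ₚ []      = a ∷ p
(a ∷ p) +ₚ (b ∷ q) = (a ℤ.+ b) ∷ (p +ₚ q)

_*ₚ_ : Polynomial → Polynomial → Polynomial
[]      *ₚ q = []
(a ∷ p) *ₚ q = List.map (a ℤ.*_) q +ₚ (0ℤ ∷ (p *ₚ q))

_^ₚ_ : Polynomial → ℕ → Polynomial
p ^ₚ zero  = 1ℤ ∷ []
p ^ₚ suc k = p *ₚ (p ^ₚ k)

x-1 : Polynomial
x-1 = -1ℤ ∷ 1ℤ ∷ []

interlace : Graph n → Polynomial
interlace {n} G =
  List.foldr _+ₚ_ [] (List.map (λ ω → x-1 ^ₚ corank (adjacency G [ ω ])) (𝔽₂^ n))

-- H is partial; invertibility of A Γ + A + I is what makes it defined.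
H : (A Γ : Matrix n n) → Invertible (A *ᴹ Γ +ᴹ A +ᴹ 𝐈) → Matrix n n
H A Γ (N , _) = ((A +ᴹ 𝐈) *ᴹ Γ +ᴹ A) *ᴹ N

Σₑ : Graph n → Pred (Vec 𝔽₂ n) 0ℓ
Σₑ G x = ∃ λ inv → H (diag x) (adjacency G) inv ≡ adjacency G

anyMatrix? : {P : Pred (Matrix m n) 0ℓ} → Decidable P → Dec (∃ P)
anyMatrix? {zero}  P? = map′ ([] ,_) (λ { ([] , p) → p }) (P? [])
anyMatrix? {suc m} P? = map′ (λ (r , M , p) → r ∷ M , p) (λ { (r ∷ M , p) → r , M , p })
  (anySubset? λ r → anyMatrix? λ M → P? (r ∷ M))

Σₑ? : (G : Graph n) → Decidable (Σₑ G)
Σₑ? {n} G x = map′ (λ (N , inv , eq) → (N , inv) , eq) (λ ((N , inv) , eq) → N , inv , eq)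
  (anyMatrix? λ N → ((M *ᴹ N) ≟ᴹ 𝐈 ×-dec (N *ᴹ M) ≟ᴹ 𝐈)
                    ×-dec (((diag x +ᴹ 𝐈) *ᴹ Γ +ᴹ diag x) *ᴹ N) ≟ᴹ Γ)
  where
  Γ M : Matrix n n
  Γ = adjacency G
  M = diag x *ᴹ Γ +ᴹ diag x +ᴹ 𝐈

#Σₑ : Graph n → ℕ
#Σₑ {n} G = List.length (List.filter (Σₑ? G) (𝔽₂^ n))

{-# OPTIONS --safe #-}
module Submission where

-- Let P = Γ + I and write x ⊙ v for x̂ v.  Then x ∈ Σₑ(G) means P (x ⊙ P v) = 0 for all v.
-- The kernel of Γ[ω] corresponds to { v ∣ P (ω ⊙ v) = v } through u ↦ P u and v ↦ v|ω, where u
-- is extended by zero outside ω.  Any v in this set lies in the image of P, so P (x ⊙ v) = 0 for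
-- x ∈ Σₑ(G) and the set is the same for ω and ω ⊕ x.  Hence corank Γ[ω] is invariant under
-- translation of ω by the group Σₑ(G), which acts freely on the subsets.

open import Defs
open import Algebra.Bundles using (AbelianGroup; CommutativeRing)
open import Data.Bool using (Bool; true; false; if_then_else_; _∧_; _xor_)
open import Data.Bool.Properties as Bool
  using (xor-assoc; xor-comm; xor-identityˡ; xor-identityʳ; xor-same; xor-∧-commutativeRing;
         ∧-assoc; ∧-comm; ∧-idem; ∧-zeroʳ; ∧-distribˡ-xor; ∧-distribʳ-xor)
open import Data.Fin using (Fin; zero; suc; combine; funToFin; finToFun)
open import Data.Fin.Properties
  using (2↔Bool; finToFun-funToFin; funToFin-finToFin; injective⇒≤) renaming (_≟_ to _≟ᶠ_)
open import Data.Fin.Subset using (Subset; ∣_∣)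
open import Data.Fin.Subset.Properties using (anySubset?)
open import Data.Integer as ℤ using (ℤ; 0ℤ; 1ℤ; +_)
open import Data.Integer.Divisibility using (_∣_)
open import Data.Integer.Divisibility.Signed as Signed using (divides; ∣m∣n⇒∣m+n; ∣⇒∣ᵤ)
open import Data.Integer.Properties as ℤ using ()
open import Data.List as List using (List; []; _∷_; _++_)
open import Data.List.Properties as List using ()
open import Data.Nat using (ℕ; zero; suc; _≤_; _^_; s≤s; z≤n)
open import Data.Nat.Properties using (≤-antisym; ≮⇒≥; <⇒≱; ^-monoʳ-<)
open import Data.Product using (∃; _×_; _,_; proj₁; proj₂)
open import Data.Vec as Vec using (Vec; []; _∷_; lookup; tabulate; zipWith)
open import Data.Vec.Properties as Vec
  using (≡-dec; lookup∘tabulate; tabulate∘lookup; tabulate-cong; lookup-map; lookup-zipWith)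
open import Data.Vec.Relation.Unary.All using (All; []; _∷_)
open import Function using (_∘_; Inverse; mk⇔; _⇔_)
open import Level using (0ℓ)
open import Relation.Binary.PropositionalEquality
  using (_≡_; _≢_; refl; sym; trans; cong; cong₂; subst; isEquivalence; module ≡-Reasoning)
open import Relation.Nullary using (¬_; Dec; yes; no; does)
open import Relation.Nullary.Decidable
  using (¬?; _×-dec_; does-⇔; dec-false; decidable-stable)
open import Relation.Nullary.Negation using (contradiction)
open import Relation.Unary using (Pred; Decidable; _≐_; ｛_｝)

open import Algebra.Properties.Semiring.Sum (CommutativeRing.semiring xor-∧-commutativeRing)
  using (*-distribˡ-sum; *-distribʳ-sum; ∑-comm)

open ≡-Reasoning

private
  variable
    d d′ m n k : ℕ

-- Vector addition and the coordinatewise product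

lookup-ext : ∀ {A : Set} {u v : Vec A n} → (∀ i → lookup u i ≡ lookup v i) → u ≡ v
lookup-ext {u = u} {v} eq = trans (sym (tabulate∘lookup u)) (trans (tabulate-cong eq) (tabulate∘lookup v))

⊕-self : (u : Vec 𝔽₂ n) → u ⊕ u ≡ 𝟎
⊕-self []      = refl
⊕-self (a ∷ u) = cong₂ _∷_ (xor-same a) (⊕-self u)

-- In characteristic 2 every vector is its own inverse, so the library's cancellation laws,
-- re-exported below, become laws about `_⊕_` alone.
⊕-abelianGroup : ℕ → AbelianGroup 0ℓ 0ℓ
⊕-abelianGroup n = record
  { Carrier = Vec 𝔽₂ n
  ; _≈_     = _≡_
  ; _∙_     = _⊕_
  ; ε       = 𝟎
  ; _⁻¹     = λ u → u
  ; isAbelianGroup = record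
    { isGroup = record
      { isMonoid = record
        { isSemigroup = record
          { isMagma = record { isEquivalence = isEquivalence ; ∙-cong = cong₂ _⊕_ }
          ; assoc   = Vec.zipWith-assoc xor-assoc
          }
        ; identity = Vec.zipWith-identityˡ xor-identityˡ , Vec.zipWith-identityʳ xor-identityʳ
        }
      ; inverse = ⊕-self , ⊕-self
      ; ⁻¹-cong = λ eq → eq
      }
    ; comm = Vec.zipWith-comm xor-comm
    }
  }

module ⊕ {n : ℕ} where
  open AbelianGroup (⊕-abelianGroup n) public using (assoc; comm; identityˡ; identityʳ)
  open import Algebra.Properties.AbelianGroup (⊕-abelianGroup n) public
    using (∙-cancelʳ; x∙y⁻¹≈ε⇒x≈y; //-rightDividesʳ)
  open import Algebra.Properties.CommutativeSemigroup
    (AbelianGroup.commutativeSemigroup (⊕-abelianGroup n)) public using (interchange; xy∙z≈xz∙y)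

infixr 7 _⊙_

_⊙_ : Vec 𝔽₂ n → Vec 𝔽₂ n → Vec 𝔽₂ n
_⊙_ = zipWith _∧_

⊙-distribˡ-⊕ : (x u v : Vec 𝔽₂ n) → x ⊙ (u ⊕ v) ≡ x ⊙ u ⊕ x ⊙ v
⊙-distribˡ-⊕ = Vec.zipWith-distribˡ ∧-distribˡ-xor

⊙-distribʳ-⊕ : (v x y : Vec 𝔽₂ n) → (x ⊕ y) ⊙ v ≡ x ⊙ v ⊕ y ⊙ v
⊙-distribʳ-⊕ = Vec.zipWith-distribʳ ∧-distribʳ-xor

⊙-zeroˡ : (v : Vec 𝔽₂ n) → 𝟎 ⊙ v ≡ 𝟎
⊙-zeroˡ = Vec.zipWith-zeroˡ (λ _ → refl)

⊙-absorb : (x v : Vec 𝔽₂ n) → x ⊙ x ⊙ v ≡ x ⊙ v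
⊙-absorb x v = trans (sym (Vec.zipWith-assoc ∧-assoc x x v)) (cong (_⊙ v) (Vec.zipWith-idem ∧-idem x))

-- Matrices as linear operators

∑-δˡ : (i : Fin n) (f : Fin n → 𝔽₂) → ∑[ j < n ] (does (i ≟ᶠ j) ∧ f j) ≡ f i
∑-δˡ {suc n} zero    f = trans (cong (f zero xor_) (sum-replicate-zero n)) (xor-identityʳ (f zero))
-- The head term computes to `false` and `does (suc i ≟ᶠ suc j)` reduces to `does (i ≟ᶠ j)`, so the
-- induction hypothesis has the required type as it stands.
∑-δˡ {suc n} (suc i) f = ∑-δˡ i (f ∘ suc)

entry-matrix : (f : Fin m → Fin n → 𝔽₂) (i : Fin m) (j : Fin n) → entry (matrix f) i j ≡ f i j
entry-matrix f i j = trans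
  (cong (λ r → lookup r j) (lookup∘tabulate (λ i → tabulate (f i)) i))
  (lookup∘tabulate (f i) j)

lookup-*ᵥ : (M : Matrix m n) (v : Vec 𝔽₂ n) (i : Fin m) →
            lookup (M *ᵥ v) i ≡ ∑[ j < n ] (entry M i j ∧ lookup v j)
lookup-*ᵥ M v = lookup∘tabulate _

lookup-matrix-*ᵥ : (f : Fin m → Fin n → 𝔽₂) (v : Vec 𝔽₂ n) (i : Fin m) →
                   lookup (matrix f *ᵥ v) i ≡ ∑[ j < n ] (f i j ∧ lookup v j)
lookup-matrix-*ᵥ f v i = trans (lookup-*ᵥ (matrix f) v i)
  (sum-cong-≗ λ j → cong (_∧ lookup v j) (entry-matrix f i j))

*ᵥ-distribˡ-⊕ : (M : Matrix m n) (u v : Vec 𝔽₂ n) → M *ᵥ (u ⊕ v) ≡ M *ᵥ u ⊕ M *ᵥ v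
*ᵥ-distribˡ-⊕ {n = n} M u v = lookup-ext λ i → begin
  lookup (M *ᵥ (u ⊕ v)) i
    ≡⟨ lookup-*ᵥ M (u ⊕ v) i ⟩
  ∑[ j < n ] (entry M i j ∧ lookup (u ⊕ v) j)
    ≡⟨ sum-cong-≗ (λ j → trans (cong (entry M i j ∧_) (lookup-zipWith _xor_ j u v))
                               (∧-distribˡ-xor (entry M i j) _ _)) ⟩
  ∑[ j < n ] ((entry M i j ∧ lookup u j) xor (entry M i j ∧ lookup v j))
    ≡⟨ ∑-distrib-+ (λ j → entry M i j ∧ lookup u j) (λ j → entry M i j ∧ lookup v j) ⟩
  ∑[ j < n ] (entry M i j ∧ lookup u j) xor ∑[ j < n ] (entry M i j ∧ lookup v j)
    ≡⟨ cong₂ _xor_ (lookup-*ᵥ M u i) (lookup-*ᵥ M v i) ⟨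
  lookup (M *ᵥ u) i xor lookup (M *ᵥ v) i
    ≡⟨ lookup-zipWith _xor_ i (M *ᵥ u) (M *ᵥ v) ⟨
  lookup (M *ᵥ u ⊕ M *ᵥ v) i ∎

*ᵥ-distribʳ-+ᴹ : (v : Vec 𝔽₂ n) (M N : Matrix m n) → (M +ᴹ N) *ᵥ v ≡ M *ᵥ v ⊕ N *ᵥ v
*ᵥ-distribʳ-+ᴹ {n = n} v M N = lookup-ext λ i → begin
  lookup ((M +ᴹ N) *ᵥ v) i
    ≡⟨ lookup-matrix-*ᵥ _ v i ⟩
  ∑[ j < n ] ((entry M i j xor entry N i j) ∧ lookup v j)
    ≡⟨ sum-cong-≗ (λ j → ∧-distribʳ-xor (lookup v j) (entry M i j) (entry N i j)) ⟩
  ∑[ j < n ] ((entry M i j ∧ lookup v j) xor (entry N i j ∧ lookup v j))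
    ≡⟨ ∑-distrib-+ (λ j → entry M i j ∧ lookup v j) (λ j → entry N i j ∧ lookup v j) ⟩
  ∑[ j < n ] (entry M i j ∧ lookup v j) xor ∑[ j < n ] (entry N i j ∧ lookup v j)
    ≡⟨ cong₂ _xor_ (lookup-*ᵥ M v i) (lookup-*ᵥ N v i) ⟨
  lookup (M *ᵥ v) i xor lookup (N *ᵥ v) i
    ≡⟨ lookup-zipWith _xor_ i (M *ᵥ v) (N *ᵥ v) ⟨
  lookup (M *ᵥ v ⊕ N *ᵥ v) i ∎

*ᴹ-*ᵥ-assoc : (M : Matrix m k) (N : Matrix k n) (v : Vec 𝔽₂ n) → (M *ᴹ N) *ᵥ v ≡ M *ᵥ (N *ᵥ v)
*ᴹ-*ᵥ-assoc {k = k} {n = n} M N v = lookup-ext λ i → begin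
  lookup ((M *ᴹ N) *ᵥ v) i
    ≡⟨ lookup-matrix-*ᵥ _ v i ⟩
  ∑[ j < n ] (∑[ l < k ] (entry M i l ∧ entry N l j) ∧ lookup v j)
    ≡⟨ sum-cong-≗ (λ j → *-distribʳ-sum (lookup v j) (λ l → entry M i l ∧ entry N l j)) ⟩
  ∑[ j < n ] ∑[ l < k ] ((entry M i l ∧ entry N l j) ∧ lookup v j)
    ≡⟨ ∑-comm (λ j l → (entry M i l ∧ entry N l j) ∧ lookup v j) ⟩
  ∑[ l < k ] ∑[ j < n ] ((entry M i l ∧ entry N l j) ∧ lookup v j)
    ≡⟨ sum-cong-≗ (λ l → sum-cong-≗ λ j → ∧-assoc (entry M i l) (entry N l j) (lookup v j)) ⟩
  ∑[ l < k ] ∑[ j < n ] (entry M i l ∧ (entry N l j ∧ lookup v j))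
    ≡⟨ sum-cong-≗ (λ l → *-distribˡ-sum (entry M i l) (λ j → entry N l j ∧ lookup v j)) ⟨
  ∑[ l < k ] (entry M i l ∧ ∑[ j < n ] (entry N l j ∧ lookup v j))
    ≡⟨ sum-cong-≗ (λ l → cong (entry M i l ∧_) (lookup-*ᵥ N v l)) ⟨
  ∑[ l < k ] (entry M i l ∧ lookup (N *ᵥ v) l)
    ≡⟨ lookup-*ᵥ M (N *ᵥ v) i ⟨
  lookup (M *ᵥ (N *ᵥ v)) i ∎

𝐈-*ᵥ : (v : Vec 𝔽₂ n) → 𝐈 *ᵥ v ≡ v
𝐈-*ᵥ v = lookup-ext λ i → trans (lookup-matrix-*ᵥ _ v i) (∑-δˡ i (lookup v))

diag-*ᵥ : (x v : Vec 𝔽₂ n) → diag x *ᵥ v ≡ x ⊙ v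
diag-*ᵥ {n} x v = lookup-ext λ i → begin
  lookup (diag x *ᵥ v) i                                   ≡⟨ lookup-matrix-*ᵥ _ v i ⟩
  ∑[ j < n ] ((does (i ≟ᶠ j) ∧ lookup x i) ∧ lookup v j)
    ≡⟨ sum-cong-≗ (λ j → ∧-assoc (does (i ≟ᶠ j)) (lookup x i) (lookup v j)) ⟩
  ∑[ j < n ] (does (i ≟ᶠ j) ∧ (lookup x i ∧ lookup v j))   ≡⟨ ∑-δˡ i _ ⟩
  lookup x i ∧ lookup v i                                  ≡⟨ lookup-zipWith _∧_ i x v ⟨
  lookup (x ⊙ v) i                                         ∎

unit : Fin n → Vec 𝔽₂ n
unit j = tabulate λ k → does (j ≟ᶠ k)

lookup-*ᵥ-unit : (M : Matrix m n) (i : Fin m) (j : Fin n) → lookup (M *ᵥ unit j) i ≡ entry M i j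
lookup-*ᵥ-unit {n = n} M i j = begin
  lookup (M *ᵥ unit j) i
    ≡⟨ lookup-*ᵥ M (unit j) i ⟩
  ∑[ k < n ] (entry M i k ∧ lookup (unit j) k)
    ≡⟨ sum-cong-≗ (λ k → trans (cong (entry M i k ∧_) (lookup∘tabulate _ k)) (∧-comm (entry M i k) _)) ⟩
  ∑[ k < n ] (does (j ≟ᶠ k) ∧ entry M i k)
    ≡⟨ ∑-δˡ j (entry M i) ⟩
  entry M i j ∎

-- Evaluation at `unit j` reads off column `j`. Matrix identities can therefore be checked as
-- identities of operators.
*ᵥ-ext : {M N : Matrix m n} → (∀ v → M *ᵥ v ≡ N *ᵥ v) → M ≡ N
*ᵥ-ext {M = M} {N} eq = lookup-ext λ i → lookup-ext λ j →
  trans (sym (lookup-*ᵥ-unit M i j))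
        (trans (cong (λ w → lookup w i) (eq (unit j))) (lookup-*ᵥ-unit N i j))

-- The space Σₑ

module _ (Γ : Matrix n n) where

  P : Vec 𝔽₂ n → Vec 𝔽₂ n
  P v = Γ *ᵥ v ⊕ v

  P-⊕ : ∀ u v → P (u ⊕ v) ≡ P u ⊕ P v
  P-⊕ u v = trans (cong (_⊕ (u ⊕ v)) (*ᵥ-distribˡ-⊕ Γ u v)) (⊕.interchange _ _ u v)

  P-𝟎 : P 𝟎 ≡ 𝟎
  P-𝟎 = trans (⊕.identityʳ _) (IsSubspace.𝟎-closed (Kernel-isSubspace Γ))

  P-recover : ∀ v → P v ⊕ v ≡ Γ *ᵥ v
  P-recover v = ⊕.//-rightDividesʳ v (Γ *ᵥ v)

  -- The vector form of (Γ + I) x̂ (Γ + I) = 0.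
  Fixes : Pred (Vec 𝔽₂ n) 0ℓ
  Fixes x = ∀ v → P (x ⊙ P v) ≡ 𝟎

  Fixes-isSubspace : IsSubspace Fixes
  Fixes-isSubspace = record
    { 𝟎-closed = λ v → trans (cong P (⊙-zeroˡ (P v))) P-𝟎
    ; ⊕-closed = λ {x} {y} fx fy v → begin
        P ((x ⊕ y) ⊙ P v)           ≡⟨ cong P (⊙-distribʳ-⊕ (P v) x y) ⟩
        P (x ⊙ P v ⊕ y ⊙ P v)       ≡⟨ P-⊕ _ _ ⟩
        P (x ⊙ P v) ⊕ P (y ⊙ P v)   ≡⟨ cong₂ _⊕_ (fx v) (fy v) ⟩
        𝟎 ⊕ 𝟎                       ≡⟨ ⊕-self 𝟎 ⟩
        𝟎                           ∎
    }

  module _ (x : Vec 𝔽₂ n) where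

    numerator denominator : Matrix n n
    numerator   = (diag x +ᴹ 𝐈) *ᴹ Γ +ᴹ diag x
    denominator = diag x *ᴹ Γ +ᴹ diag x +ᴹ 𝐈

    denominator-*ᵥ : ∀ v → denominator *ᵥ v ≡ x ⊙ P v ⊕ v
    denominator-*ᵥ v = begin
      denominator *ᵥ v
        ≡⟨ *ᵥ-distribʳ-+ᴹ v (diag x *ᴹ Γ +ᴹ diag x) 𝐈 ⟩
      (diag x *ᴹ Γ +ᴹ diag x) *ᵥ v ⊕ 𝐈 *ᵥ v
        ≡⟨ cong₂ _⊕_ (*ᵥ-distribʳ-+ᴹ v (diag x *ᴹ Γ) (diag x)) (𝐈-*ᵥ v) ⟩
      (diag x *ᴹ Γ) *ᵥ v ⊕ diag x *ᵥ v ⊕ v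
        ≡⟨ cong (_⊕ v) (cong₂ _⊕_ (trans (*ᴹ-*ᵥ-assoc (diag x) Γ v) (diag-*ᵥ x _)) (diag-*ᵥ x v)) ⟩
      x ⊙ (Γ *ᵥ v) ⊕ x ⊙ v ⊕ v
        ≡⟨ cong (_⊕ v) (⊙-distribˡ-⊕ x (Γ *ᵥ v) v) ⟨
      x ⊙ P v ⊕ v ∎

    numerator-*ᵥ : ∀ v → numerator *ᵥ v ≡ x ⊙ P v ⊕ Γ *ᵥ v
    numerator-*ᵥ v = begin
      numerator *ᵥ v
        ≡⟨ *ᵥ-distribʳ-+ᴹ v ((diag x +ᴹ 𝐈) *ᴹ Γ) (diag x) ⟩
      ((diag x +ᴹ 𝐈) *ᴹ Γ) *ᵥ v ⊕ diag x *ᵥ v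
        ≡⟨ cong₂ _⊕_ (*ᴹ-*ᵥ-assoc (diag x +ᴹ 𝐈) Γ v) (diag-*ᵥ x v) ⟩
      (diag x +ᴹ 𝐈) *ᵥ (Γ *ᵥ v) ⊕ x ⊙ v
        ≡⟨ cong (_⊕ x ⊙ v) (*ᵥ-distribʳ-+ᴹ (Γ *ᵥ v) (diag x) 𝐈) ⟩
      diag x *ᵥ (Γ *ᵥ v) ⊕ 𝐈 *ᵥ (Γ *ᵥ v) ⊕ x ⊙ v
        ≡⟨ cong (_⊕ x ⊙ v) (cong₂ _⊕_ (diag-*ᵥ x _) (𝐈-*ᵥ _)) ⟩
      x ⊙ (Γ *ᵥ v) ⊕ Γ *ᵥ v ⊕ x ⊙ v
        ≡⟨ ⊕.xy∙z≈xz∙y _ _ _ ⟩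
      x ⊙ (Γ *ᵥ v) ⊕ x ⊙ v ⊕ Γ *ᵥ v
        ≡⟨ cong (_⊕ Γ *ᵥ v) (⊙-distribˡ-⊕ x (Γ *ᵥ v) v) ⟨
      x ⊙ P v ⊕ Γ *ᵥ v ∎

    -- Put `z = x ⊙ P v`. The denominator sends `v` to `z ⊕ v` and the numerator sends it to
    -- `z ⊕ Γ *ᵥ v`. If `H` equals `Γ`, then the numerator is `Γ` times the denominator; cancelling
    -- `Γ *ᵥ v` leaves `Γ *ᵥ z ≡ z`, that is, `P z ≡ 𝟎`.
    H≡⇒Fixes : (inv : Invertible denominator) → H (diag x) Γ inv ≡ Γ → Fixes x
    H≡⇒Fixes (N , _ , N*D) H≡Γ v = trans (cong (_⊕ z) (⊕.∙-cancelʳ (Γ *ᵥ v) _ _ Γz⊕Γv)) (⊕-self z)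
      where
      z : Vec 𝔽₂ n
      z = x ⊙ P v

      Γz⊕Γv : Γ *ᵥ z ⊕ Γ *ᵥ v ≡ z ⊕ Γ *ᵥ v
      Γz⊕Γv = begin
        Γ *ᵥ z ⊕ Γ *ᵥ v                         ≡⟨ *ᵥ-distribˡ-⊕ Γ z v ⟨
        Γ *ᵥ (z ⊕ v)                            ≡⟨ cong (Γ *ᵥ_) (denominator-*ᵥ v) ⟨
        Γ *ᵥ (denominator *ᵥ v)                 ≡⟨ cong (_*ᵥ (denominator *ᵥ v)) H≡Γ ⟨
        (numerator *ᴹ N) *ᵥ (denominator *ᵥ v)  ≡⟨ *ᴹ-*ᵥ-assoc numerator N (denominator *ᵥ v) ⟩
        numerator *ᵥ (N *ᵥ (denominator *ᵥ v))  ≡⟨ cong (numerator *ᵥ_) (*ᴹ-*ᵥ-assoc N denominator v) ⟨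
        numerator *ᵥ ((N *ᴹ denominator) *ᵥ v)  ≡⟨ cong (λ M → numerator *ᵥ (M *ᵥ v)) N*D ⟩
        numerator *ᵥ (𝐈 *ᵥ v)                   ≡⟨ cong (numerator *ᵥ_) (𝐈-*ᵥ v) ⟩
        numerator *ᵥ v                          ≡⟨ numerator-*ᵥ v ⟩
        z ⊕ Γ *ᵥ v                              ∎

    -- The denominator x̂ (Γ + I) + I is an involution, because (x̂ (Γ + I))² = 0.
    Fixes⇒H≡ : Fixes x → ∃ λ inv → H (diag x) Γ inv ≡ Γ
    Fixes⇒H≡ fx = (denominator , involutive , involutive) , *ᵥ-ext H-*ᵥ
      where
      -- The denominator changes `v` by `x ⊙ P v`, which `P` kills. Both computations below collapse
      -- because of this.
      P-denominator : ∀ v → P (denominator *ᵥ v) ≡ P v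
      P-denominator v = begin
        P (denominator *ᵥ v)    ≡⟨ cong P (denominator-*ᵥ v) ⟩
        P (x ⊙ P v ⊕ v)         ≡⟨ P-⊕ _ v ⟩
        P (x ⊙ P v) ⊕ P v       ≡⟨ cong (_⊕ P v) (fx v) ⟩
        𝟎 ⊕ P v                 ≡⟨ ⊕.identityˡ (P v) ⟩
        P v                     ∎

      cancel : (u v : Vec 𝔽₂ n) → u ⊕ (u ⊕ v) ≡ v
      cancel u v = trans (sym (⊕.assoc u u v)) (trans (cong (_⊕ v) (⊕-self u)) (⊕.identityˡ v))

      involutive : denominator *ᴹ denominator ≡ 𝐈
      involutive = *ᵥ-ext λ v → begin
        (denominator *ᴹ denominator) *ᵥ v                ≡⟨ *ᴹ-*ᵥ-assoc denominator denominator v ⟩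
        denominator *ᵥ (denominator *ᵥ v)                ≡⟨ denominator-*ᵥ (denominator *ᵥ v) ⟩
        x ⊙ P (denominator *ᵥ v) ⊕ denominator *ᵥ v
          ≡⟨ cong₂ (λ p q → x ⊙ p ⊕ q) (P-denominator v) (denominator-*ᵥ v) ⟩
        x ⊙ P v ⊕ (x ⊙ P v ⊕ v)                          ≡⟨ cancel _ v ⟩
        v                                                ≡⟨ 𝐈-*ᵥ v ⟨
        𝐈 *ᵥ v                                           ∎

      H-*ᵥ : ∀ v → (numerator *ᴹ denominator) *ᵥ v ≡ Γ *ᵥ v
      H-*ᵥ v = begin
        (numerator *ᴹ denominator) *ᵥ v                  ≡⟨ *ᴹ-*ᵥ-assoc numerator denominator v ⟩
        numerator *ᵥ w                                   ≡⟨ numerator-*ᵥ w ⟩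
        -- Writing `Γ *ᵥ w` as `P w ⊕ w` leaves only `P w`, which equals `P v`, and `w` itself; the
        -- two copies of `x ⊙ P v` then cancel.
        x ⊙ P w ⊕ Γ *ᵥ w                                 ≡⟨ cong (x ⊙ P w ⊕_) (P-recover w) ⟨
        x ⊙ P w ⊕ (P w ⊕ w)
          ≡⟨ cong₂ (λ p q → x ⊙ p ⊕ (p ⊕ q)) (P-denominator v) (denominator-*ᵥ v) ⟩
        x ⊙ P v ⊕ (P v ⊕ (x ⊙ P v ⊕ v))                  ≡⟨ cong (x ⊙ P v ⊕_) (⊕.comm (P v) _) ⟩
        x ⊙ P v ⊕ (x ⊙ P v ⊕ v ⊕ P v)                    ≡⟨ cong (x ⊙ P v ⊕_) (⊕.assoc _ v (P v)) ⟩
        x ⊙ P v ⊕ (x ⊙ P v ⊕ (v ⊕ P v))                  ≡⟨ cancel _ _ ⟩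
        v ⊕ P v                                          ≡⟨ ⊕.comm v (P v) ⟩
        P v ⊕ v                                          ≡⟨ P-recover v ⟩
        Γ *ᵥ v                                           ∎
        where
        w : Vec 𝔽₂ n
        w = denominator *ᵥ v

-- This trades a condition involving a matrix inverse for one that is linear in `x`, from which
-- closure under addition can be read off.
Σₑ⇔Fixes : (G : Graph n) (x : Vec 𝔽₂ n) → Σₑ G x ⇔ Fixes (adjacency G) x
Σₑ⇔Fixes G x = mk⇔ (λ (inv , eq) → H≡⇒Fixes (adjacency G) x inv eq) (Fixes⇒H≡ (adjacency G) x)

-- Principal submatrices

-- The recursion on `ω` follows the computation of `∣ ω ∣`, so lengths agree definitionally. The
-- link with the enumeration `elements` is made by `lookup-restrict` and `∑-elements`.
extend : (ω : Subset n) → Vec 𝔽₂ ∣ ω ∣ → Vec 𝔽₂ n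
extend []          []      = []
extend (true  ∷ ω) (a ∷ u) = a ∷ extend ω u
extend (false ∷ ω) u       = false ∷ extend ω u

restrict : (ω : Subset n) → Vec 𝔽₂ n → Vec 𝔽₂ ∣ ω ∣
restrict []          []      = []
restrict (true  ∷ ω) (a ∷ v) = a ∷ restrict ω v
restrict (false ∷ ω) (a ∷ v) = restrict ω v

restrict-extend : (ω : Subset n) (u : Vec 𝔽₂ ∣ ω ∣) → restrict ω (extend ω u) ≡ u
restrict-extend []          []      = refl
restrict-extend (true  ∷ ω) (a ∷ u) = cong (a ∷_) (restrict-extend ω u)
restrict-extend (false ∷ ω) u       = restrict-extend ω u

extend-restrict : (ω : Subset n) (v : Vec 𝔽₂ n) → extend ω (restrict ω v) ≡ ω ⊙ v
extend-restrict []          []      = refl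
extend-restrict (true  ∷ ω) (a ∷ v) = cong (a ∷_) (extend-restrict ω v)
extend-restrict (false ∷ ω) (a ∷ v) = cong (false ∷_) (extend-restrict ω v)

⊙-extend : (ω : Subset n) (u : Vec 𝔽₂ ∣ ω ∣) → ω ⊙ extend ω u ≡ extend ω u
⊙-extend ω u = trans (sym (extend-restrict ω _)) (cong (extend ω) (restrict-extend ω u))

extend-injective : (ω : Subset n) {u v : Vec 𝔽₂ ∣ ω ∣} → extend ω u ≡ extend ω v → u ≡ v
extend-injective ω {u} {v} eq =
  trans (sym (restrict-extend ω u)) (trans (cong (restrict ω) eq) (restrict-extend ω v))

extend-𝟎 : (ω : Subset n) → extend ω 𝟎 ≡ 𝟎
extend-𝟎 []          = refl
extend-𝟎 (true  ∷ ω) = cong (false ∷_) (extend-𝟎 ω)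
extend-𝟎 (false ∷ ω) = cong (false ∷_) (extend-𝟎 ω)

lookup-restrict : (ω : Subset n) (v : Vec 𝔽₂ n) (i : Fin ∣ ω ∣) →
                  lookup (restrict ω v) i ≡ lookup v (lookup (elements ω) i)
lookup-restrict (true  ∷ ω) (a ∷ v) zero    = refl
lookup-restrict (true  ∷ ω) (a ∷ v) (suc i) = trans (lookup-restrict ω v i)
  (sym (cong (lookup (a ∷ v)) (lookup-map i suc (elements ω))))
lookup-restrict (false ∷ ω) (a ∷ v) i       = trans (lookup-restrict ω v i)
  (sym (cong (lookup (a ∷ v)) (lookup-map i suc (elements ω))))

-- Positions outside `ω` contribute `f j ∧ false`, so they may be added to the sum freely.
∑-elements : (ω : Subset n) (f : Fin n → 𝔽₂) (u : Vec 𝔽₂ ∣ ω ∣) →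
             ∑[ j < ∣ ω ∣ ] (f (lookup (elements ω) j) ∧ lookup u j) ≡
             ∑[ j < n ] (f j ∧ lookup (extend ω u) j)
∑-elements []          f []      = refl
∑-elements (true  ∷ ω) f (a ∷ u) = cong ((f zero ∧ a) xor_) (trans
  (sum-cong-≗ λ j → cong (λ i → f i ∧ lookup u j) (lookup-map j suc (elements ω)))
  (∑-elements ω (f ∘ suc) u))
∑-elements {suc n} (false ∷ ω) f u = trans
  (sum-cong-≗ λ j → cong (λ i → f i ∧ lookup u j) (lookup-map j suc (elements ω)))
  (trans (∑-elements ω (f ∘ suc) u)
         (cong (_xor ∑[ j < n ] (f (suc j) ∧ lookup (extend ω u) j)) (sym (∧-zeroʳ (f zero)))))

-- A principal submatrix is the compression of the operator `M` to the coordinates in `ω`. After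
-- this the enumeration `elements` no longer enters.
submatrix-*ᵥ : (M : Matrix n n) (ω : Subset n) (u : Vec 𝔽₂ ∣ ω ∣) →
               M [ ω ] *ᵥ u ≡ restrict ω (M *ᵥ extend ω u)
submatrix-*ᵥ {n} M ω u = lookup-ext λ i → begin
  lookup (M [ ω ] *ᵥ u) i                                  ≡⟨ lookup-matrix-*ᵥ _ u i ⟩
  ∑[ j < ∣ ω ∣ ] (entry M (e i) (e j) ∧ lookup u j)        ≡⟨ ∑-elements ω (entry M (e i)) u ⟩
  ∑[ j < n ] (entry M (e i) j ∧ lookup (extend ω u) j)     ≡⟨ lookup-*ᵥ M (extend ω u) (e i) ⟨
  lookup (M *ᵥ extend ω u) (e i)                           ≡⟨ lookup-restrict ω _ i ⟨
  lookup (restrict ω (M *ᵥ extend ω u)) i                  ∎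
  where
  e : Fin ∣ ω ∣ → Fin n
  e = lookup (elements ω)

-- Kernels of principal submatrices as spaces of fixed vectors

module _ (Γ : Matrix n n) where

  -- These vectors live in the full space whatever the size of `ω`, so the spaces for `ω` and
  -- `ω ⊕ x` can be compared directly, unlike the kernels themselves.
  FixedAt : Subset n → Pred (Vec 𝔽₂ n) 0ℓ
  FixedAt ω v = P Γ (ω ⊙ v) ≡ v

  module _ (ω : Subset n) {u : Vec 𝔽₂ ∣ ω ∣} (u∈ : Kernel (Γ [ ω ]) u) where

    -- On the coordinates in `ω` the `Γ`-part of `P` vanishes, as `u` is in the kernel, and the
    -- identity part remains. Truncation to `ω` thus inverts `u ↦ P u`, which later gives
    -- injectivity.
    ⊙-P-extend : ω ⊙ P Γ (extend ω u) ≡ extend ω u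
    ⊙-P-extend = begin
      ω ⊙ P Γ (extend ω u)
        ≡⟨ ⊙-distribˡ-⊕ ω _ _ ⟩
      ω ⊙ (Γ *ᵥ extend ω u) ⊕ ω ⊙ extend ω u
        ≡⟨ cong₂ _⊕_ (sym (extend-restrict ω _)) (⊙-extend ω u) ⟩
      extend ω (restrict ω (Γ *ᵥ extend ω u)) ⊕ extend ω u
        ≡⟨ cong (λ w → extend ω w ⊕ extend ω u) (trans (sym (submatrix-*ᵥ Γ ω u)) u∈) ⟩
      extend ω 𝟎 ⊕ extend ω u
        ≡⟨ cong (_⊕ extend ω u) (extend-𝟎 ω) ⟩
      𝟎 ⊕ extend ω u
        ≡⟨ ⊕.identityˡ _ ⟩
      extend ω u ∎

    Kernel⇒FixedAt : FixedAt ω (P Γ (extend ω u))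
    Kernel⇒FixedAt = cong (P Γ) ⊙-P-extend

  -- On the coordinates in `ω`, the equation `P Γ (ω ⊙ v) ≡ v` reads `Γ *ᵥ (ω ⊙ v) ⊕ v ≡ v`, so
  -- `Γ *ᵥ (ω ⊙ v)` vanishes there. The comparison is made after `extend`, where the algebra of
  -- `_⊙_` is available.
  FixedAt⇒Kernel : ∀ ω {v} → FixedAt ω v → Kernel (Γ [ ω ]) (restrict ω v)
  FixedAt⇒Kernel ω {v} fv = extend-injective ω (begin
    extend ω (Γ [ ω ] *ᵥ restrict ω v)
      ≡⟨ cong (extend ω) (submatrix-*ᵥ Γ ω _) ⟩
    extend ω (restrict ω (Γ *ᵥ extend ω (restrict ω v)))
      ≡⟨ extend-restrict ω _ ⟩
    ω ⊙ (Γ *ᵥ extend ω (restrict ω v))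
      ≡⟨ cong (λ w → ω ⊙ (Γ *ᵥ w)) (extend-restrict ω v) ⟩
    ω ⊙ (Γ *ᵥ (ω ⊙ v))
      ≡⟨ cong (ω ⊙_) (P-recover Γ (ω ⊙ v)) ⟨
    ω ⊙ (P Γ (ω ⊙ v) ⊕ ω ⊙ v)
      ≡⟨ cong (λ w → ω ⊙ (w ⊕ ω ⊙ v)) fv ⟩
    ω ⊙ (v ⊕ ω ⊙ v)
      ≡⟨ ⊙-distribˡ-⊕ ω v _ ⟩
    ω ⊙ v ⊕ ω ⊙ ω ⊙ v
      ≡⟨ cong (ω ⊙ v ⊕_) (⊙-absorb ω v) ⟩
    ω ⊙ v ⊕ ω ⊙ v
      ≡⟨ ⊕-self _ ⟩
    𝟎
      ≡⟨ extend-𝟎 ω ⟨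
    extend ω 𝟎 ∎)

  FixedAt-translate : ∀ {x} → Fixes Γ x → ∀ ω {v} → FixedAt ω v → FixedAt (ω ⊕ x) v
  FixedAt-translate {x} fx ω {v} fv = begin
    P Γ ((ω ⊕ x) ⊙ v)                     ≡⟨ cong (P Γ) (⊙-distribʳ-⊕ v ω x) ⟩
    P Γ (ω ⊙ v ⊕ x ⊙ v)                   ≡⟨ P-⊕ Γ _ _ ⟩
    -- In the second term `v` is expanded to `P Γ (ω ⊙ v)`, the shape that `fx` annihilates.
    P Γ (ω ⊙ v) ⊕ P Γ (x ⊙ v)             ≡⟨ cong₂ _⊕_ fv (cong (λ w → P Γ (x ⊙ w)) (sym fv)) ⟩
    v ⊕ P Γ (x ⊙ P Γ (ω ⊙ v))             ≡⟨ cong (v ⊕_) (fx (ω ⊙ v)) ⟩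
    v ⊕ 𝟎                                 ≡⟨ ⊕.identityʳ v ⟩
    v                                     ∎

-- Dimension

-- A counting argument: binary encoding turns `f` into an injection from `Fin (2 ^ d)` to
-- `Fin (2 ^ d′)`, and `2 ^_` is strictly increasing.
vec-injection⇒≤ : (f : Vec 𝔽₂ d → Vec 𝔽₂ d′) → (∀ {u v} → f u ≡ f v → u ≡ v) → d ≤ d′
vec-injection⇒≤ {d} {d′} f f-inj = ≮⇒≥ λ d′<d →
  -- The term `s≤s (s≤s z≤n)` proves `1 < 2`.
  <⇒≱ (^-monoʳ-< 2 (s≤s (s≤s z≤n)) d′<d)
      (injective⇒≤ {f = encode ∘ f ∘ decode} (decode-injective ∘ f-inj ∘ encode-injective))
  where
  open Inverse 2↔Bool

  decode : Fin (2 ^ k) → Vec 𝔽₂ k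
  decode i = tabulate (to ∘ finToFun i)

  encode : Vec 𝔽₂ k → Fin (2 ^ k)
  encode v = funToFin (from ∘ lookup v)

  decode-encode : (v : Vec 𝔽₂ k) → decode (encode v) ≡ v
  decode-encode v = trans
    (tabulate-cong λ i → trans (cong to (finToFun-funToFin (from ∘ lookup v) i)) (strictlyInverseˡ _))
    (tabulate∘lookup v)

  encode-injective : {u v : Vec 𝔽₂ k} → encode u ≡ encode v → u ≡ v
  encode-injective {u = u} {v} eq =
    trans (sym (decode-encode u)) (trans (cong decode eq) (decode-encode v))

  funToFin-cong : ∀ {k} {f g : Fin k → Fin 2} → (∀ i → f i ≡ g i) → funToFin f ≡ funToFin g
  funToFin-cong {zero}  eq = refl
  funToFin-cong {suc k} eq = cong₂ combine (eq zero) (funToFin-cong (eq ∘ suc))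

  encode-decode : (i : Fin (2 ^ k)) → encode (decode {k} i) ≡ i
  encode-decode {k} i = trans
    (funToFin-cong {k} λ j → trans (cong from (lookup∘tabulate (to ∘ finToFun i) j)) (strictlyInverseʳ _))
    (funToFin-finToFin {k} i)

  decode-injective : {i j : Fin (2 ^ k)} → decode {k} i ≡ decode j → i ≡ j
  decode-injective {k} {i} {j} eq =
    trans (sym (encode-decode {k} i)) (trans (cong encode eq) (encode-decode {k} j))

·-distribʳ-xor : (v : Vec 𝔽₂ n) (a b : 𝔽₂) → (a xor b) · v ≡ a · v ⊕ b · v
·-distribʳ-xor []      a b = refl
·-distribʳ-xor (c ∷ v) a b = cong₂ _∷_ (∧-distribʳ-xor c a b) (·-distribʳ-xor v a b)

linComb-⊕ : (c e : Vec 𝔽₂ d) (B : Vec (Vec 𝔽₂ n) d) →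
            linComb (c ⊕ e) B ≡ linComb c B ⊕ linComb e B
linComb-⊕ []       []       []       = sym (⊕-self 𝟎)
linComb-⊕ (a ∷ c) (a′ ∷ e) (b ∷ B) = trans
  (cong₂ _⊕_ (·-distribʳ-xor b a a′) (linComb-⊕ c e B)) (⊕.interchange _ _ _ _)

module _ {V : Pred (Vec 𝔽₂ n) 0ℓ} where

  linComb-closed : IsSubspace V → ∀ {B : Vec (Vec 𝔽₂ n) d} → All V B → ∀ c → V (linComb c B)
  linComb-closed sub []         []      = IsSubspace.𝟎-closed sub
  linComb-closed sub (Vb ∷ VB) (a ∷ c) =
    IsSubspace.⊕-closed sub (scale a) (linComb-closed sub VB c)
    where
    scale : ∀ a → V (a · _)
    scale true  = subst V (sym (Vec.map-id _)) Vb
    scale false = subst V (sym (Vec.map-const _ false)) (IsSubspace.𝟎-closed sub)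

  linComb-injective : ∀ {B : Vec (Vec 𝔽₂ n) d} → IsBasis V B →
                      ∀ {c e} → linComb c B ≡ linComb e B → c ≡ e
  linComb-injective {B = B} basis {c} {e} eq = ⊕.x∙y⁻¹≈ε⇒x≈y c e
    (IsBasis.independent basis
      (trans (linComb-⊕ c e B) (trans (cong (_⊕ linComb e B) eq) (⊕-self _))))

-- Coordinates with respect to `B` and `C` turn `f` into an injection from `Vec 𝔽₂ d` to
-- `Vec 𝔽₂ d′`.
injection⇒dim-≤ : {V : Pred (Vec 𝔽₂ m) 0ℓ} {W : Pred (Vec 𝔽₂ n) 0ℓ}
                  {B : Vec (Vec 𝔽₂ m) d} {C : Vec (Vec 𝔽₂ n) d′} →
                  IsSubspace V → IsBasis V B → IsBasis W C →
                  (f : Vec 𝔽₂ m → Vec 𝔽₂ n) → (∀ {v} → V v → W (f v)) →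
                  (∀ {u v} → V u → V v → f u ≡ f v → u ≡ v) → d ≤ d′
injection⇒dim-≤ {d = d} {d′} {V} {W} {B} {C} sub basisB basisC f f∈W f-inj =
  vec-injection⇒≤ coords λ {c} {e} eq → linComb-injective basisB (f-inj (B∈V c) (B∈V e) (begin
    f (linComb c B)        ≡⟨ coords-correct c ⟨
    linComb (coords c) C   ≡⟨ cong (λ c → linComb c C) eq ⟩
    linComb (coords e) C   ≡⟨ coords-correct e ⟩
    f (linComb e B)        ∎))
  where
  B∈V : ∀ c → V (linComb c B)
  B∈V = linComb-closed sub (IsBasis.members basisB)

  coords : Vec 𝔽₂ d → Vec 𝔽₂ d′
  coords c = proj₁ (IsBasis.spanning basisC (f∈W (B∈V c)))

  coords-correct : ∀ c → linComb (coords c) C ≡ f (linComb c B)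
  coords-correct c = proj₂ (IsBasis.spanning basisC (f∈W (B∈V c)))

-- Invariance of the corank under translation

module _ (Γ : Matrix n n) {x : Vec 𝔽₂ n} (fx : Fixes Γ x) where

  -- A kernel vector goes to its fixed vector for `ω`, which is also fixed for `ω ⊕ x`, and then to
  -- the kernel for `ω ⊕ x`. For injectivity, `recover` gets the fixed vector back from its
  -- restriction, and truncation to `ω` then returns `extend ω u`.
  corank-translate-≤ : ∀ ω → corank (Γ [ ω ]) ≤ corank (Γ [ ω ⊕ x ])
  corank-translate-≤ ω = injection⇒dim-≤ (Kernel-isSubspace (Γ [ ω ]))
    (proj₂ (proj₂ (kernel-basis (Γ [ ω ])))) (proj₂ (proj₂ (kernel-basis (Γ [ ω ⊕ x ]))))
    (λ u → restrict (ω ⊕ x) (P Γ (extend ω u)))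
    (FixedAt⇒Kernel Γ (ω ⊕ x) ∘ fixed)
    λ {u} {v} u∈ v∈ eq → extend-injective ω (begin
      extend ω u                            ≡⟨ ⊙-P-extend Γ ω u∈ ⟨
      ω ⊙ P Γ (extend ω u)                  ≡⟨ cong (ω ⊙_) (recover u∈) ⟨
      ω ⊙ P Γ (extend (ω ⊕ x) (restrict (ω ⊕ x) (P Γ (extend ω u))))
        ≡⟨ cong (λ w → ω ⊙ P Γ (extend (ω ⊕ x) w)) eq ⟩
      ω ⊙ P Γ (extend (ω ⊕ x) (restrict (ω ⊕ x) (P Γ (extend ω v))))
        ≡⟨ cong (ω ⊙_) (recover v∈) ⟩
      ω ⊙ P Γ (extend ω v)                  ≡⟨ ⊙-P-extend Γ ω v∈ ⟩
      extend ω v                            ∎)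
    where
    fixed : ∀ {u} → Kernel (Γ [ ω ]) u → FixedAt Γ (ω ⊕ x) (P Γ (extend ω u))
    fixed u∈ = FixedAt-translate Γ fx ω (Kernel⇒FixedAt Γ ω u∈)

    recover : ∀ {u} → Kernel (Γ [ ω ]) u →
              P Γ (extend (ω ⊕ x) (restrict (ω ⊕ x) (P Γ (extend ω u)))) ≡ P Γ (extend ω u)
    recover u∈ = trans (cong (P Γ) (extend-restrict (ω ⊕ x) _)) (fixed u∈)

  corank-translate : ∀ ω → corank (Γ [ ω ⊕ x ]) ≡ corank (Γ [ ω ])
  corank-translate ω = ≤-antisym
    -- The reverse inequality is the same lemma at `ω ⊕ x`, since translating twice by `x` returns
    -- `ω`.
    (subst (λ τ → corank (Γ [ ω ⊕ x ]) ≤ corank (Γ [ τ ])) (⊕.//-rightDividesʳ x ω)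
           (corank-translate-≤ (ω ⊕ x)))
    (corank-translate-≤ ω)

-- Sums over 𝔽₂ⁿ of translation-invariant functions

sumℤ : List ℤ → ℤ
sumℤ = List.foldr ℤ._+_ 0ℤ

sumℤ-++ : ∀ xs ys → sumℤ (xs ++ ys) ≡ sumℤ xs ℤ.+ sumℤ ys
sumℤ-++ []       ys = sym (ℤ.+-identityˡ _)
sumℤ-++ (x ∷ xs) ys = trans (cong (ℤ._+_ x) (sumℤ-++ xs ys)) (sym (ℤ.+-assoc x _ _))

total : (Vec 𝔽₂ n → ℤ) → ℤ
total {n} h = sumℤ (List.map h (𝔽₂^ n))

total-cong : {g h : Vec 𝔽₂ n → ℤ} → (∀ v → g v ≡ h v) → total g ≡ total h
total-cong {n} eq = cong sumℤ (List.map-cong eq (𝔽₂^ n))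

total-suc : (h : Vec 𝔽₂ (suc n) → ℤ) → total h ≡ total (h ∘ (false ∷_)) ℤ.+ total (h ∘ (true ∷_))
total-suc {n} h = begin
  sumℤ (List.map h (List.map (false ∷_) (𝔽₂^ n) ++ List.map (true ∷_) (𝔽₂^ n)))
    ≡⟨ cong sumℤ (List.map-++ h (List.map (false ∷_) (𝔽₂^ n)) _) ⟩
  sumℤ (List.map h (List.map (false ∷_) (𝔽₂^ n)) ++ List.map h (List.map (true ∷_) (𝔽₂^ n)))
    ≡⟨ sumℤ-++ (List.map h (List.map (false ∷_) (𝔽₂^ n))) _ ⟩
  sumℤ (List.map h (List.map (false ∷_) (𝔽₂^ n))) ℤ.+ sumℤ (List.map h (List.map (true ∷_) (𝔽₂^ n)))
    ≡⟨ cong₂ (λ xs ys → sumℤ xs ℤ.+ sumℤ ys) (List.map-∘ (𝔽₂^ n)) (List.map-∘ (𝔽₂^ n)) ⟨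
  total (h ∘ (false ∷_)) ℤ.+ total (h ∘ (true ∷_)) ∎

total-zero : ∀ n → total {n} (λ _ → 0ℤ) ≡ 0ℤ
total-zero zero    = refl
total-zero (suc n) = trans (total-suc {n} (λ _ → 0ℤ)) (cong₂ ℤ._+_ (total-zero n) (total-zero n))

-- The leading bit of `u` keeps or swaps the two halves of the cube, and the tail permutes each half
-- by induction.
total-translate : (u : Vec 𝔽₂ n) (h : Vec 𝔽₂ n → ℤ) → total (λ v → h (v ⊕ u)) ≡ total h
total-translate []      h = refl
total-translate (a ∷ u) h = begin
  total (λ v → h (v ⊕ (a ∷ u)))
    ≡⟨ total-suc (λ v → h (v ⊕ (a ∷ u))) ⟩
  total (λ v → h (a ∷ (v ⊕ u))) ℤ.+ total (λ v → h ((true xor a) ∷ (v ⊕ u)))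
    ≡⟨ cong₂ ℤ._+_ (total-translate u (h ∘ (a ∷_))) (total-translate u (h ∘ ((true xor a) ∷_))) ⟩
  total (h ∘ (a ∷_)) ℤ.+ total (h ∘ ((true xor a) ∷_))
    ≡⟨ swap a ⟩
  total (h ∘ (false ∷_)) ℤ.+ total (h ∘ (true ∷_))
    ≡⟨ total-suc h ⟨
  total h ∎
  where
  swap : ∀ a → total (h ∘ (a ∷_)) ℤ.+ total (h ∘ ((true xor a) ∷_)) ≡
               total (h ∘ (false ∷_)) ℤ.+ total (h ∘ (true ∷_))
  swap false = refl
  swap true  = ℤ.+-comm (total (h ∘ (true ∷_))) _

-- Translation by `true ∷ u` carries one half of the cube onto the other, with tails shifted by `u`;
-- the shift does not affect the total.
total-double : (u : Vec 𝔽₂ n) {h : Vec 𝔽₂ (suc n) → ℤ} → (∀ v → h (v ⊕ (true ∷ u)) ≡ h v) →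
               total h ≡ total (h ∘ (false ∷_)) ℤ.+ total (h ∘ (false ∷_))
total-double u {h} inv = trans (total-suc h) (cong (ℤ._+_ (total (h ∘ (false ∷_))))
  (trans (total-cong (sym ∘ inv ∘ (true ∷_))) (total-translate u (h ∘ (false ∷_)))))

indicator : {V : Pred (Vec 𝔽₂ n) 0ℓ} → Decidable V → Vec 𝔽₂ n → ℤ
indicator V? v = if does (V? v) then 1ℤ else 0ℤ

-- Expressing the size of `V` as a total lets the divisor and the dividend be split by the same
-- lemmas.
length-filter : {V : Pred (Vec 𝔽₂ n) 0ℓ} (V? : Decidable V) (vs : List (Vec 𝔽₂ n)) →
                + List.length (List.filter V? vs) ≡ sumℤ (List.map (indicator V?) vs)
length-filter V? []       = refl
length-filter V? (v ∷ vs) with does (V? v)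
... | true  = cong (ℤ._+_ 1ℤ) (length-filter V? vs)
... | false = trans (length-filter V? vs) (sym (ℤ.+-identityˡ _))

indicator-translate : {V : Pred (Vec 𝔽₂ n) 0ℓ} (V? : Decidable V) → IsSubspace V →
                      ∀ {x} → V x → ∀ v → indicator V? (v ⊕ x) ≡ indicator V? v
indicator-translate {V = V} V? sub {x} Vx v = cong (if_then 1ℤ else 0ℤ)
  (does-⇔ (mk⇔ (λ Vvx → subst V (⊕.//-rightDividesʳ x v) (⊕-closed Vvx Vx)) (λ Vv → ⊕-closed Vv Vx))
          (V? (v ⊕ x)) (V? v))
  where open IsSubspace sub

double-∣ : ∀ {i j} → i Signed.∣ j → i ℤ.+ i Signed.∣ j ℤ.+ j
double-∣ {i} (divides q refl) = divides q (sym (ℤ.*-distribˡ-+ q i i))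

-- Induction on the leading coordinate stands in for a choice of coset representatives. The tails of
-- the vectors of `V` with leading `false` form a subspace that preserves both halves of `h`. If `V`
-- also has a vector with leading `true`, then its size and the total are both doubled; otherwise
-- its size is that of the subspace, which divides both halves.
∣V∣∣total : {V : Pred (Vec 𝔽₂ n) 0ℓ} (V? : Decidable V) → IsSubspace V →
            (h : Vec 𝔽₂ n → ℤ) → (∀ {x} → V x → ∀ v → h (v ⊕ x) ≡ h v) →
            total (indicator V?) Signed.∣ total h
∣V∣∣total {zero} V? sub h inv with V? []
-- The only vector lies in `V`, so the divisor is `1ℤ`.
... | yes _  = divides (total h) (sym (ℤ.*-identityʳ (total h)))
... | no ¬V𝟎 = contradiction (IsSubspace.𝟎-closed sub) ¬V𝟎
∣V∣∣total {suc n} {V} V? sub h inv = split (anySubset? (V? ∘ (true ∷_)))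
  where
  open IsSubspace sub

  half : ∀ a → total (indicator (V? ∘ (false ∷_))) Signed.∣ total (h ∘ (a ∷_))
  half a = ∣V∣∣total (V? ∘ (false ∷_)) (record { 𝟎-closed = 𝟎-closed ; ⊕-closed = ⊕-closed })
    (h ∘ (a ∷_)) λ {x} Vx v →
      -- Translation by `false ∷ x` turns the leading bit into `a xor false`, which for a variable
      -- `a` does not reduce.
      trans (cong (λ b → h (b ∷ (v ⊕ x))) (sym (xor-identityʳ a))) (inv Vx (a ∷ v))

  split : Dec (∃ λ u → V (true ∷ u)) → total (indicator V?) Signed.∣ total h
  split (yes (u , Vu))
    rewrite total-double u (indicator-translate V? sub Vu) | total-double u {h} (inv Vu) =
    double-∣ (half false)
  split (no ∄u)
    -- The indicator of `V` vanishes on the half with leading `true`, so only the other half is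
    -- counted.
    rewrite total-suc (indicator V?)
          | total-cong {g = indicator V? ∘ (true ∷_)} {h = λ _ → 0ℤ}
              (λ u → cong (if_then 1ℤ else 0ℤ) (dec-false (V? (true ∷ u)) (∄u ∘ (u ,_))))
          | total-zero n | ℤ.+-identityʳ (total (indicator (V? ∘ (false ∷_))))
          | total-suc h =
    ∣m∣n⇒∣m+n (half false) (half true)

-- A non-zero translation pairs off the vectors, and `h` is constant on pairs. The recursion runs to
-- the first `true` in `x`, where `total-double` applies.
2∣total : (x : Vec 𝔽₂ n) → x ≢ 𝟎 → (h : Vec 𝔽₂ n → ℤ) → (∀ v → h (v ⊕ x) ≡ h v) →
          + 2 Signed.∣ total h
2∣total []          x≢𝟎 h inv = contradiction refl x≢𝟎
2∣total (true  ∷ x) x≢𝟎 h inv rewrite total-double x {h} inv =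
  -- Here `+ 2` is read as `1ℤ ℤ.+ 1ℤ`, to which it is equal by computation.
  double-∣ {1ℤ} {total (h ∘ (false ∷_))} (divides (total (h ∘ (false ∷_))) (sym (ℤ.*-identityʳ _)))
2∣total (false ∷ x) x≢𝟎 h inv rewrite total-suc h = ∣m∣n⇒∣m+n (half false) (half true)
  where
  half : ∀ a → + 2 Signed.∣ total (h ∘ (a ∷_))
  half a = 2∣total x (x≢𝟎 ∘ cong (false ∷_)) (h ∘ (a ∷_)) λ v →
    trans (cong (λ b → h (b ∷ (v ⊕ x))) (sym (xor-identityʳ a))) (inv (a ∷ v))

-- Coefficients of the interlace polynomial

coeff-+ₚ : ∀ p q i → coeff (p +ₚ q) i ≡ coeff p i ℤ.+ coeff q i
coeff-+ₚ []      q       i       = sym (ℤ.+-identityˡ _)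
coeff-+ₚ (a ∷ p) []      i       = sym (ℤ.+-identityʳ _)
coeff-+ₚ (a ∷ p) (b ∷ q) zero    = refl
coeff-+ₚ (a ∷ p) (b ∷ q) (suc i) = coeff-+ₚ p q i

coeff-sum : ∀ {A : Set} (f : A → Polynomial) as i →
            coeff (List.foldr _+ₚ_ [] (List.map f as)) i ≡ sumℤ (List.map (λ a → coeff (f a) i) as)
coeff-sum f []       i = refl
coeff-sum f (a ∷ as) i = trans (coeff-+ₚ (f a) _ i) (cong (ℤ._+_ (coeff (f a) i)) (coeff-sum f as i))

proposition12 : ∀ {n : ℕ} (G : Graph n) →
    (∀ (i : ℕ) → + (#Σₑ G) ∣ coeff (interlace G) i)
    × (¬ (Σₑ G ≐ ｛ 𝟎 ｝) → ∀ (i : ℕ) → + 2 ∣ coeff (interlace G) i)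
proposition12 {n} G =
    (λ i → subst (+ (#Σₑ G) ∣_) (sym (coeff-interlace i))
             (∣⇒∣ᵤ (subst (Signed._∣ total (summand i)) (sym (length-filter (Σₑ? G) (𝔽₂^ n)))
               (∣V∣∣total (Σₑ? G) Σₑ-isSubspace (summand i) (summand-translate i)))))
  , λ Σₑ≢｛𝟎｝ i → let x , Σx , x≢𝟎 = nonzero Σₑ≢｛𝟎｝ in
      subst (+ 2 ∣_) (sym (coeff-interlace i))
            (∣⇒∣ᵤ (2∣total x x≢𝟎 (summand i) (summand-translate i Σx)))
  where
  open Function.Equivalence using (to; from)

  Γ : Matrix n n
  Γ = adjacency G

  summand : ℕ → Subset n → ℤ
  summand i ω = coeff (x-1 ^ₚ corank (Γ [ ω ])) i

  coeff-interlace : ∀ i → coeff (interlace G) i ≡ total (summand i)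
  coeff-interlace = coeff-sum (λ ω → x-1 ^ₚ corank (Γ [ ω ])) (𝔽₂^ n)

  summand-translate : ∀ i {x} → Σₑ G x → ∀ ω → summand i (ω ⊕ x) ≡ summand i ω
  summand-translate i {x} Σx ω =
    cong (λ s → coeff (x-1 ^ₚ s) i) (corank-translate Γ (to (Σₑ⇔Fixes G x) Σx) ω)

  Σₑ-isSubspace : IsSubspace (Σₑ G)
  Σₑ-isSubspace = record
    { 𝟎-closed = from (Σₑ⇔Fixes G 𝟎) 𝟎-closed
    ; ⊕-closed = λ {x} {y} Σx Σy →
        from (Σₑ⇔Fixes G (x ⊕ y)) (⊕-closed (to (Σₑ⇔Fixes G x) Σx) (to (Σₑ⇔Fixes G y) Σy))
    }
    where open IsSubspace (Fixes-isSubspace Γ)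

  nonzero : ¬ (Σₑ G ≐ ｛ 𝟎 ｝) → ∃ λ x → Σₑ G x × x ≢ 𝟎
  -- The hypothesis is only a negation. A finite search decides whether a non-zero element exists,
  -- so it is enough to refute its absence, which would force the space to be zero.
  nonzero Σₑ≢｛𝟎｝ = decidable-stable (anySubset? λ x → Σₑ? G x ×-dec ¬? (≡-dec Bool._≟_ x 𝟎))
    λ ∄x → Σₑ≢｛𝟎｝
      ( (λ {x} Σx → sym (decidable-stable (≡-dec Bool._≟_ x 𝟎) λ x≢𝟎 → ∄x (x , Σx , x≢𝟎)))
      , λ { refl → IsSubspace.𝟎-closed Σₑ-isSubspace })
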